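{- Let $p$ be an odd prime with $p\equiv 3\pmod 4$. For all integers $A\geq C\geq 1$ and $B\geq D\geq 1$, $$\mathcal R(A,B;C,D)\in\mathbb Z_p[i].$$
   Context: For integers $A\geq C\geq 1$ and $B\geq D\geq 1$, the rectangular Gaussian binomial coefficient is the element of $\mathbb Q(i)$ $$\mathcal R(A,B;C,D):=\frac{\prod_{n=0}^{C-1}\prod_{m=0}^{D-1}\bigl(A+Bi-(n+mi)\bigr)}{\prod_{n=1}^{C}\prod_{m=1}^{D}(n+mi)}=\frac{\prod_{x=A-C+1}^{A}\prod_{y=B-D+1}^{B}(x+iy)}{\prod_{x=1}^{C}\prod_{y=1}^{D}(x+iy)}.$$ For a prime $p\equiv 3\pmod 4$, $\mathbb Q(i)$ is viewed inside $\mathbb Q_p(i)$, the unramified quadratic extension of $\mathbb Q_p$, whose ring of integers is $\mathbb Z_p[i]$. -}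

module Defs where

open import Data.Nat as ℕ using (ℕ; zero; suc)
import Data.Nat.Properties as ℕP
open import Data.Nat.Divisibility using (_∤_)
open import Data.Nat.Primality using (Prime; euclidsLemma; prime⇒nonTrivial)
import Data.Nat.Divisibility as ∣
open import Data.Integer as ℤ using (ℤ; +_)
import Data.Integer.Properties as ℤP
open import Data.Rational as ℚ using (ℚ; 0ℚ; 1ℚ; Positive)
import Data.Rational.Properties as ℚP
import Data.Rational.Unnormalised as ℚᵘ
import Data.Rational.Unnormalised.Properties as ℚᵘP
open import Data.Rational.Solver using (module +-*-Solver)
open import Data.Product using (∃; ∃₂; _×_; _,_)
open import Data.Sum using ([_,_]′)
open import Relation.Binary.PropositionalEquality
  using (_≡_; refl; sym; trans; cong; cong₂; subst; module ≡-Reasoning)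

infix 5 _+i_

record ℚ[i] : Set where
  constructor _+i_
  field
    re im : ℚ

open ℚ[i] public

infixl 6 _⊕_ _⊖_
infixl 7 _⊗_ _⊘_

_⊕_ _⊖_ _⊗_ : ℚ[i] → ℚ[i] → ℚ[i]
(a +i b) ⊕ (c +i d) = (a ℚ.+ c) +i (b ℚ.+ d)
(a +i b) ⊖ (c +i d) = (a ℚ.- c) +i (b ℚ.- d)
(a +i b) ⊗ (c +i d) = (a ℚ.* c ℚ.- b ℚ.* d) +i (a ℚ.* d ℚ.+ b ℚ.* c)

norm : ℚ[i] → ℚ
norm (a +i b) = a ℚ.* a ℚ.+ b ℚ.* b

-- z⁻¹ = z̄ / N(z).  The side condition N(z) ≠ 0 is equivalent to z ≠ 0.
inv : (z : ℚ[i]) .{{_ : ℚ.NonZero (norm z)}} → ℚ[i]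
inv z@(a +i b) = (a ℚ.* ℚ.1/ norm z) +i (ℚ.- b ℚ.* ℚ.1/ norm z)

_⊘_ : (z w : ℚ[i]) .{{_ : ℚ.NonZero (norm w)}} → ℚ[i]
z ⊘ w = z ⊗ inv w

1[i] : ℚ[i]
1[i] = 1ℚ +i 0ℚ

ℤ→ℚ : ℤ → ℚ
ℤ→ℚ n = n ℚ./ 1

infix 8 _+_i

_+_i : ℕ → ℕ → ℚ[i]
x + y i = ℤ→ℚ (+ x) +i ℤ→ℚ (+ y)

∏ : ℕ → (ℕ → ℚ[i]) → ℚ[i]
∏ zero    f = 1[i]
∏ (suc k) f = ∏ k f ⊗ f k

numerator : (A B C D : ℕ) → ℚ[i]
numerator A B C D = ∏ C λ n → ∏ D λ m → (A + B i) ⊖ (n + m i)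

-- ∏ is indexed from 0, so suc gives the index ranges 1 ≤ n ≤ C and 1 ≤ m ≤ D.
denominator : (C D : ℕ) → ℚ[i]
denominator C D = ∏ C λ n → ∏ D λ m → suc n + suc m i

norm-⊗ : ∀ z w → norm (z ⊗ w) ≡ norm z ℚ.* norm w
norm-⊗ (a +i b) (c +i d) = solve 4 (λ a b c d →
    (a :* c :- b :* d) :* (a :* c :- b :* d) :+ (a :* d :+ b :* c) :* (a :* d :+ b :* c)
    := (a :* a :+ b :* b) :* (c :* c :+ d :* d)) refl a b c d
  where open +-*-Solver

norm-∏-pos : ∀ k f → (∀ j → Positive (norm (f j))) → Positive (norm (∏ k f))
norm-∏-pos zero    f h = _
norm-∏-pos (suc k) f h = subst Positive (sym (norm-⊗ (∏ k f) (f k)))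
  (ℚP.pos*pos⇒pos (norm (∏ k f)) {{norm-∏-pos k f h}} (norm (f k)) {{h k}})

norm-suc-pos : ∀ x y → Positive (norm (suc x + suc y i))
norm-suc-pos x y = ℚP.pos+pos⇒pos (q x ℚ.* q x) {{sq x}} (q y ℚ.* q y) {{sq y}}
  where
  q : ℕ → ℚ
  q x = ℤ→ℚ (+ suc x)
  sq : ∀ x → Positive (q x ℚ.* q x)
  sq x = ℚP.pos*pos⇒pos (q x) {{ℚP.normalize-pos (suc x) 1}}
                        (q x) {{ℚP.normalize-pos (suc x) 1}}

denominator≢0 : ∀ C D → ℚ.NonZero (norm (denominator C D))
denominator≢0 C D = ℚP.pos⇒nonZero (norm (denominator C D)) {{pos}}
  where
  pos : Positive (norm (denominator C D))
  pos = norm-∏-pos C _ λ n → norm-∏-pos D _ λ m → norm-suc-pos n m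

ℛ : (A B C D : ℕ) → ℚ[i]
ℛ A B C D = (numerator A B C D ⊘ denominator C D) {{denominator≢0 C D}}

-- |q|ₚ ≤ p⁻ᵏ, i.e. q = pᵏ a / b for integers a, b with p ∤ b
∣_∣[_]≤^-_ : ℚ → ℕ → ℕ → Set
∣ q ∣[ p ]≤^- k =
  ∃₂ λ (a : ℤ) (b : ℕ) → p ∤ b × q ℚ.* ℤ→ℚ (+ b) ≡ ℤ→ℚ (+ (p ℕ.^ k) ℤ.* a)

Eventually : (ℕ → Set) → Set
Eventually P = ∃ λ N → ∀ n → N ℕ.≤ n → P n

-- The completion of ℚ at |·|ₚ, as a setoid under _≈_ below.
record ℚₚ (p : ℕ) : Set where
  field
    seq    : ℕ → ℚ
    cauchy : ∀ k → ∃ λ N → ∀ m n → N ℕ.≤ m → N ℕ.≤ n →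
             ∣ seq m ℚ.- seq n ∣[ p ]≤^- k

open ℚₚ public

infix 4 _≈_

_≈_ : ∀ {p} → ℚₚ p → ℚₚ p → Set
_≈_ {p} x y = ∀ k → Eventually λ n → ∣ seq x n ℚ.- seq y n ∣[ p ]≤^- k

-- ℤₚ = { x ∈ ℚₚ : |x|ₚ ≤ 1 }.  As |·|ₚ is discrete away from 0, |seq x n|ₚ
-- is eventually |x|ₚ (or tends to 0 if x ≈ 0).
_∈ℤₚ : ∀ {p} → ℚₚ p → Set
_∈ℤₚ {p} x = Eventually λ n → ∣ seq x n ∣[ p ]≤^- 0

-- x +i y stands for x + iy; this is a field (quadratic over ℚₚ) when p ≡ 3 (mod 4).
record ℚₚ[i] (p : ℕ) : Set where
  constructor _+i_
  field
    reₚ imₚ : ℚₚ p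

_∈ℤₚ[i] : ∀ {p} → ℚₚ[i] p → Set
(x +i y) ∈ℤₚ[i] = x ∈ℤₚ × y ∈ℤₚ

ℤ→ℚ-* : ∀ m n → ℤ→ℚ (m ℤ.* n) ≡ ℤ→ℚ m ℚ.* ℤ→ℚ n
ℤ→ℚ-* m n = ℚP.toℚᵘ-injective (begin
  ℚ.toℚᵘ (ℤ→ℚ (m ℤ.* n))                  ≈⟨ ℚP.toℚᵘ-fromℚᵘ (ℚᵘ.mkℚᵘ (m ℤ.* n) 0) ⟩
  ℚᵘ.mkℚᵘ m 0 ℚᵘ.* ℚᵘ.mkℚᵘ n 0            ≈⟨ ℚᵘP.*-cong (ℚP.toℚᵘ-fromℚᵘ (ℚᵘ.mkℚᵘ m 0))
                                                        (ℚP.toℚᵘ-fromℚᵘ (ℚᵘ.mkℚᵘ n 0)) ⟨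
  ℚ.toℚᵘ (ℤ→ℚ m) ℚᵘ.* ℚ.toℚᵘ (ℤ→ℚ n)      ≈⟨ ℚP.toℚᵘ-homo-* (ℤ→ℚ m) (ℤ→ℚ n) ⟨
  ℚ.toℚᵘ (ℤ→ℚ m ℚ.* ℤ→ℚ n)                ∎)
  where open ℚᵘP.≃-Reasoning

ℤ→ℚ-- : ∀ m n → ℤ→ℚ (m ℤ.- n) ≡ ℤ→ℚ m ℚ.- ℤ→ℚ n
ℤ→ℚ-- m n = ℚP.toℚᵘ-injective (begin
  ℚ.toℚᵘ (ℤ→ℚ (m ℤ.- n))                  ≈⟨ ℚP.toℚᵘ-fromℚᵘ (ℚᵘ.mkℚᵘ (m ℤ.- n) 0) ⟩
  ℚᵘ.mkℚᵘ (m ℤ.- n) 0                     ≡⟨ cong (λ z → ℚᵘ.mkℚᵘ z 0)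
                                               (cong₂ ℤ._+_ (ℤP.*-identityʳ m) (ℤP.*-identityʳ (ℤ.- n))) ⟨
  ℚᵘ.mkℚᵘ m 0 ℚᵘ.- ℚᵘ.mkℚᵘ n 0            ≈⟨ ℚᵘP.+-cong (ℚP.toℚᵘ-fromℚᵘ (ℚᵘ.mkℚᵘ m 0))
                                               (ℚᵘP.-‿cong (ℚP.toℚᵘ-fromℚᵘ (ℚᵘ.mkℚᵘ n 0))) ⟨
  ℚ.toℚᵘ (ℤ→ℚ m) ℚᵘ.- ℚ.toℚᵘ (ℤ→ℚ n)      ≈⟨ ℚᵘP.+-congʳ (ℚ.toℚᵘ (ℤ→ℚ m)) (ℚP.toℚᵘ-homo‿- (ℤ→ℚ n)) ⟨
  ℚ.toℚᵘ (ℤ→ℚ m) ℚᵘ.+ ℚ.toℚᵘ (ℚ.- ℤ→ℚ n)  ≈⟨ ℚP.toℚᵘ-homo-+ (ℤ→ℚ m) (ℚ.- ℤ→ℚ n) ⟨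
  ℚ.toℚᵘ (ℤ→ℚ m ℚ.- ℤ→ℚ n)                ∎)
  where open ℚᵘP.≃-Reasoning

ultrametric : ∀ {p} → Prime p → ∀ k q r → ∣ q ∣[ p ]≤^- k → ∣ r ∣[ p ]≤^- k →
              ∣ q ℚ.- r ∣[ p ]≤^- k
ultrametric {p} pp k q r (a , b , p∤b , e) (c , d , p∤d , f) =
  (a ℤ.* + d ℤ.- c ℤ.* + b) , b ℕ.* d ,
  (λ h → [ p∤b , p∤d ]′ (euclidsLemma b d pp h)) ,
  (begin
    (q ℚ.- r) ℚ.* ℤ→ℚ (+ (b ℕ.* d))
      ≡⟨ cong (λ z → (q ℚ.- r) ℚ.* ℤ→ℚ z) (ℤP.pos-* b d) ⟩
    (q ℚ.- r) ℚ.* ℤ→ℚ (+ b ℤ.* + d)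
      ≡⟨ cong ((q ℚ.- r) ℚ.*_) (ℤ→ℚ-* (+ b) (+ d)) ⟩
    (q ℚ.- r) ℚ.* (B ℚ.* D)
      ≡⟨ solve 4 (λ q r b d → (q :- r) :* (b :* d) := (q :* b) :* d :- (r :* d) :* b) refl q r B D ⟩
    (q ℚ.* B) ℚ.* D ℚ.- (r ℚ.* D) ℚ.* B
      ≡⟨ cong₂ (λ x y → x ℚ.* D ℚ.- y ℚ.* B) (trans e (ℤ→ℚ-* P a)) (trans f (ℤ→ℚ-* P c)) ⟩
    (ℤ→ℚ P ℚ.* ℤ→ℚ a) ℚ.* D ℚ.- (ℤ→ℚ P ℚ.* ℤ→ℚ c) ℚ.* B
      ≡⟨ solve 5 (λ p a d c b → (p :* a) :* d :- (p :* c) :* b := p :* (a :* d :- c :* b)) refl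
           (ℤ→ℚ P) (ℤ→ℚ a) D (ℤ→ℚ c) B ⟩
    ℤ→ℚ P ℚ.* (ℤ→ℚ a ℚ.* D ℚ.- ℤ→ℚ c ℚ.* B)
      ≡⟨ cong (ℤ→ℚ P ℚ.*_) (cong₂ ℚ._-_ (ℤ→ℚ-* a (+ d)) (ℤ→ℚ-* c (+ b))) ⟨
    ℤ→ℚ P ℚ.* (ℤ→ℚ (a ℤ.* + d) ℚ.- ℤ→ℚ (c ℤ.* + b))
      ≡⟨ cong (ℤ→ℚ P ℚ.*_) (ℤ→ℚ-- (a ℤ.* + d) (c ℤ.* + b)) ⟨
    ℤ→ℚ P ℚ.* ℤ→ℚ (a ℤ.* + d ℤ.- c ℤ.* + b)
      ≡⟨ ℤ→ℚ-* P (a ℤ.* + d ℤ.- c ℤ.* + b) ⟨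
    ℤ→ℚ (P ℤ.* (a ℤ.* + d ℤ.- c ℤ.* + b)) ∎)
  where
  open ≡-Reasoning
  open +-*-Solver
  P = + (p ℕ.^ k)
  B = ℤ→ℚ (+ b)
  D = ℤ→ℚ (+ d)

∈ℤₚ-resp-≈ : ∀ {p} → Prime p → {x y : ℚₚ p} → x ≈ y → x ∈ℤₚ → y ∈ℤₚ
∈ℤₚ-resp-≈ {p} pp {x} {y} x≈y (M , h) with x≈y 0
... | N , g = M ℕ.+ N , λ n le →
  subst (∣_∣[ p ]≤^- 0)
    (solve 2 (λ u v → u :- (u :- v) := v) refl (seq x n) (seq y n))
    (ultrametric pp 0 (seq x n) (seq x n ℚ.- seq y n)
                    (h n (ℕP.≤-trans (ℕP.m≤m+n M N) le))
                    (g n (ℕP.≤-trans (ℕP.m≤n+m N M) le)))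
  where open +-*-Solver

∣0∣≤ : ∀ {p} → Prime p → ∀ k → ∣ 0ℚ ∣[ p ]≤^- k
∣0∣≤ {p} pp k = + 0 , 1 , (λ p∣1 → ℕ.nonTrivial⇒≢1 {{prime⇒nonTrivial pp}} (∣.∣1⇒≡1 p∣1)) ,
  cong ℤ→ℚ (sym (ℤP.*-zeroʳ (+ (p ℕ.^ k))))

constₚ : ∀ {p} → Prime p → ℚ → ℚₚ p
constₚ {p} pp q = record
  { seq    = λ _ → q
  ; cauchy = λ k → 0 , λ _ _ _ _ → subst (∣_∣[ p ]≤^- k) (sym (ℚP.+-inverseʳ q)) (∣0∣≤ pp k)
  }

embed : ∀ {p} → Prime p → ℚ[i] → ℚₚ[i] p
embed pp (a +i b) = constₚ pp a +i constₚ pp b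

{-# OPTIONS --safe #-}

-- For p ≡ 3 (mod 4) inert in ℤ[i] the valuation of x + iy is min(v(x), v(y)), i.e.
-- the number of k ≥ 1 with pᵏ ∣ x and pᵏ ∣ y.  Summing over a box X × Y and exchanging
-- sums, the valuation of the product is Σₖ |X ∩ pᵏℤ| · |Y ∩ pᵏℤ|.  Among C consecutive
-- integers at least ⌊C/pᵏ⌋ are multiples of pᵏ, with equality for 1, …, C; hence the
-- numerator has at least the valuation of the denominator.
module Submission where

open import Data.Empty using (⊥-elim)
open import Data.Integer as ℤ using (+_)
import Data.Integer.Properties as ℤP
open import Data.Nat
open import Data.Nat.Coprimality using (Coprime; coprime-Bézout)
open import Data.Nat.Divisibility
open import Data.Nat.DivMod
open import Data.Nat.GCD using (module Bézout)
open import Data.Nat.Induction using (<-rec)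
open import Data.Nat.Primality
  using (Prime; euclidsLemma; prime⇒irreducible; prime⇒nonTrivial; prime⇒nonZero)
open import Data.Nat.Properties
import Data.Nat.Tactic.RingSolver as ℕR
open import Data.Product using (∃; _×_; _,_; proj₁; proj₂)
open import Data.Rational as ℚ using (ℚ; 1ℚ)
import Data.Rational.Properties as ℚP
open import Data.Rational.Solver using (module +-*-Solver)
open import Data.Sum using (_⊎_; inj₁; inj₂; [_,_]′)
open import Relation.Binary.PropositionalEquality
  using (_≡_; refl; sym; trans; cong; cong₂; subst; module ≡-Reasoning)
open import Relation.Nullary using (¬_; yes; no; _×-dec_)
open import Defs

-- Sums of two squares modulo a prime `p ≡ 3 (mod 4)`.

even⊎odd : ∀ n → (∃ λ j → n ≡ j * 2) ⊎ (∃ λ j → n ≡ 1 + j * 2)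
even⊎odd n with n % 2 | m%n<n n 2 | m≡m%n+[m/n]*n n 2
... | 0 | _ | eq = inj₁ (n / 2 , eq)
... | 1 | _ | eq = inj₂ (n / 2 , eq)
... | suc (suc _) | s≤s (s≤s ()) | _

square-mod : ∀ n r q → n ∣ (r + q * n) * (r + q * n) + 1 → n ∣ r * r + 1
square-mod n r q h = ∣m+n∣m⇒∣n (subst (n ∣_) (eq n r q) h) (m∣m*n (q * (2 * r + q * n)))
  where
  eq : ∀ n r q → (r + q * n) * (r + q * n) + 1 ≡ n * (q * (2 * r + q * n)) + (r * r + 1)
  eq = ℕR.solve-∀

-- Modulo `s + r`, `s` is `-r`, so both have the same square. Adding `(s + r)²` keeps the identity
-- free of subtraction.
square-neg : ∀ s r → s + r ∣ r * r + 1 → s + r ∣ s * s + 1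
square-neg s r h = ∣m+n∣m⇒∣n (subst (s + r ∣_) (eq s r)
    (∣m∣n⇒∣m+n (m∣m*n (s + r)) h)) (m∣m*n (2 * r))
  where
  eq : ∀ s r → (s + r) * (s + r) + (r * r + 1) ≡ (s + r) * (2 * r) + (s * s + 1)
  eq = ℕR.solve-∀

-- Reduce `x` to its remainder modulo `n`. If that is odd, it is positive, and its negative
-- `n ∸ x % n` is below `n`, has the same square and is even because `n` is odd.
even-root : ∀ n .{{_ : NonZero n}} → n % 2 ≡ 1 → ∀ x → n ∣ x * x + 1 →
            ∃ λ j → j * 2 < n × n ∣ (j * 2) * (j * 2) + 1
even-root n odd x h with m%n<n x n | square-mod n (x % n) (x / n)
  (subst (λ z → n ∣ z * z + 1) (m≡m%n+[m/n]*n x n) h)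
... | r<n | n∣r²+1 with even⊎odd (x % n)
... | inj₁ (j , eq) = j , subst (_< n) eq r<n , subst (λ z → n ∣ z * z + 1) eq n∣r²+1
... | inj₂ (j , eq) with even⊎odd (n ∸ x % n)
...   | inj₁ (i , eq′) = i , subst (_< n) eq′ (∸-monoʳ-< (subst (0 <_) (sym eq) z<s) (<⇒≤ r<n)) ,
          subst (λ z → n ∣ z * z + 1) eq′
            (subst (_∣ s * s + 1) s+r≡n
              (square-neg s (x % n) (subst (_∣ x % n * (x % n) + 1) (sym s+r≡n) n∣r²+1)))
  where
  s = n ∸ x % n
  s+r≡n : s + x % n ≡ n
  s+r≡n = m∸n+n≡m (<⇒≤ r<n)
...   | inj₂ (i , eq′) = ⊥-elim (0≢1+n (begin
          0                        ≡⟨ m*n%n≡0 (1 + (i + j)) 2 ⟨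
          (1 + (i + j)) * 2 % 2    ≡⟨ cong (_% 2) (shape i j) ⟨
          (1 + i * 2 + (1 + j * 2)) % 2 ≡⟨ cong₂ (λ a b → (a + b) % 2) eq′ eq ⟨
          (n ∸ x % n + x % n) % 2  ≡⟨ cong (_% 2) (m∸n+n≡m (<⇒≤ r<n)) ⟩
          n % 2                    ≡⟨ odd ⟩
          1                        ∎))
  where
  open ≡-Reasoning
  shape : ∀ i j → 1 + i * 2 + (1 + j * 2) ≡ (1 + (i + j)) * 2
  shape = ℕR.solve-∀

-- Modulo 4 the residue 3 is its own inverse; the other residues of `m` are ruled out by
-- computation.
cofactor-3mod4 : ∀ m n → n % 4 ≡ 3 → m * n % 4 ≡ 1 → m % 4 ≡ 3
cofactor-3mod4 m n n≡3 mn≡1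
  with m % 4 | m%n<n m 4 | trans (sym (trans (%-distribˡ-* m n 4) (cong (λ z → (m % 4 * z) % 4) n≡3))) mn≡1
... | 0 | _ | ()
... | 1 | _ | ()
... | 2 | _ | ()
... | 3 | _ | _ = refl
... | suc (suc (suc (suc _))) | s≤s (s≤s (s≤s (s≤s ()))) | _

-- Descent: if n ∣ x² + 1, then x may be chosen even and below n, so x² + 1 = mn
-- with m < n, and mn ≡ 1 (mod 4) forces m ≡ 3 (mod 4).
3mod4⇒∤x²+1 : ∀ n → n % 4 ≡ 3 → ∀ x → n ∤ x * x + 1
3mod4⇒∤x²+1 = <-rec _ step
  where
  step : ∀ n → (∀ {m} → m < n → m % 4 ≡ 3 → ∀ x → m ∤ x * x + 1) →
         n % 4 ≡ 3 → ∀ x → n ∤ x * x + 1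
  step n rec n≡3 x n∣x²+1 with even-root n {{nz}} odd x n∣x²+1
    where
    nz : NonZero n
    nz = ≢-nonZero λ { refl → 0≢1+n n≡3 }
    odd : n % 2 ≡ 1
    odd = trans (sym (m∣n⇒o%n%m≡o%m 2 4 n (divides 2 refl))) (cong (_% 2) n≡3)
  ... | j , t<n , divides m eq =
    rec m<n (cofactor-3mod4 m n n≡3 mn≡1) t (divides n (trans eq (*-comm m n)))
    where
    t = j * 2
    mn≡1 : m * n % 4 ≡ 1
    mn≡1 = trans (cong (_% 4) (trans (sym eq) (shape j))) ([m+kn]%n≡m%n 1 (j * j) 4)
      where
      shape : ∀ j → (j * 2) * (j * 2) + 1 ≡ 1 + (j * j) * 4
      shape = ℕR.solve-∀
    1<n : 1 < n
    1<n = ≤-trans (s≤s (s≤s z≤n)) (≤-trans (≤-reflexive (sym n≡3)) (m%n≤m n 4))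
    m<n : m < n
    m<n = *-cancelʳ-< n m n (begin-strict
      m * n      ≡⟨ eq ⟨
      t * t + 1  <⟨ +-mono-≤-< (*-monoʳ-≤ t (<⇒≤ t<n)) 1<n ⟩
      t * n + n  ≡⟨ +-comm (t * n) n ⟩
      suc t * n  ≤⟨ *-monoˡ-≤ n t<n ⟩
      n * n      ∎)
      where open ≤-Reasoning

prime∤⇒coprime : ∀ {p n} → Prime p → p ∤ n → Coprime p n
prime∤⇒coprime pp p∤n (d∣p , d∣n) with prime⇒irreducible pp d∣p
... | inj₁ d≡1 = d≡1
... | inj₂ refl = ⊥-elim (p∤n d∣n)

-- If p ∤ y, Bézout gives z with zy ≡ ±1 (mod p), and then p ∣ (xz)² + 1.
∣x²+y²⇒∣y : ∀ {p} → Prime p → p % 4 ≡ 3 → ∀ x y → p ∣ x * x + y * y → p ∣ y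
∣x²+y²⇒∣y {p} pp p≡3 x y h with p ∣? y
... | yes p∣y = p∣y
... | no p∤y with coprime-Bézout (prime∤⇒coprime pp p∤y)
... | Bézout.Identity.+- k z eq = ⊥-elim (3mod4⇒∤x²+1 p p≡3 (x * z)
    (∣m+n∣m⇒∣n (subst (p ∣_) key
      (∣m∣n⇒∣m+n (∣n⇒∣m*n (z * z) h) (m∣m*n (2 * k))))
      (m∣m*n (k * (k * p)))))
  where
  -- Here `z * y ≡ -1`. The term `2kp = 2(1 + zy)` completes the square:
  -- `(zy)² + 2(1 + zy) = (1 + zy)² + 1`.
  key : z * z * (x * x + y * y) + p * (2 * k) ≡ p * (k * (k * p)) + (x * z * (x * z) + 1)
  key = begin
    z * z * (x * x + y * y) + p * (2 * k)     ≡⟨ cong (λ u → z * z * (x * x + y * y) + u) (c p k) ⟩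
    z * z * (x * x + y * y) + 2 * (k * p)     ≡⟨ cong (λ u → z * z * (x * x + y * y) + 2 * u) eq ⟨
    z * z * (x * x + y * y) + 2 * (1 + z * y) ≡⟨ a x y z ⟩
    (1 + z * y) * (1 + z * y) + (x * z * (x * z) + 1) ≡⟨ cong (λ u → u * u + (x * z * (x * z) + 1)) eq ⟩
    k * p * (k * p) + (x * z * (x * z) + 1)   ≡⟨ cong (_+ (x * z * (x * z) + 1)) (d p k) ⟩
    p * (k * (k * p)) + (x * z * (x * z) + 1) ∎
    where
    open ≡-Reasoning
    a : ∀ x y z → z * z * (x * x + y * y) + 2 * (1 + z * y)
                  ≡ (1 + z * y) * (1 + z * y) + (x * z * (x * z) + 1)
    a = ℕR.solve-∀
    c : ∀ p k → p * (2 * k) ≡ 2 * (k * p)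
    c = ℕR.solve-∀
    d : ∀ p k → k * p * (k * p) ≡ p * (k * (k * p))
    d = ℕR.solve-∀
... | Bézout.Identity.-+ k z eq = ⊥-elim (3mod4⇒∤x²+1 p p≡3 (x * z)
    (∣m+n∣m⇒∣n (subst (p ∣_) key (∣n⇒∣m*n (z * z) h)) (m∣m*n (k * (2 + k * p)))))
  where
  key : z * z * (x * x + y * y) ≡ p * (k * (2 + k * p)) + (x * z * (x * z) + 1)
  key = begin
    z * z * (x * x + y * y)                         ≡⟨ a x y z ⟩
    x * z * (x * z) + z * y * (z * y)               ≡⟨ cong (λ u → x * z * (x * z) + u * u) eq ⟨
    x * z * (x * z) + (1 + k * p) * (1 + k * p)     ≡⟨ b x z k p ⟩
    p * (k * (2 + k * p)) + (x * z * (x * z) + 1)   ∎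
    where
    open ≡-Reasoning
    a : ∀ x y z → z * z * (x * x + y * y) ≡ x * z * (x * z) + z * y * (z * y)
    a = ℕR.solve-∀
    b : ∀ x z k p → x * z * (x * z) + (1 + k * p) * (1 + k * p)
                    ≡ p * (k * (2 + k * p)) + (x * z * (x * z) + 1)
    b = ℕR.solve-∀

-- Finite sums and their interchange.

Σ< : ℕ → (ℕ → ℕ) → ℕ
Σ< zero    f = 0
Σ< (suc k) f = Σ< k f + f k

Σ<-cong : ∀ k {f g : ℕ → ℕ} → (∀ j → f j ≡ g j) → Σ< k f ≡ Σ< k g
Σ<-cong zero    h = refl
Σ<-cong (suc k) h = cong₂ _+_ (Σ<-cong k h) (h k)

Σ<-mono : ∀ k {f g : ℕ → ℕ} → (∀ j → f j ≤ g j) → Σ< k f ≤ Σ< k g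
Σ<-mono zero    h = z≤n
Σ<-mono (suc k) h = +-mono-≤ (Σ<-mono k h) (h k)

Σ<-0 : ∀ k → Σ< k (λ _ → 0) ≡ 0
Σ<-0 zero    = refl
Σ<-0 (suc k) = trans (+-identityʳ _) (Σ<-0 k)

Σ<-+ : ∀ k (f g : ℕ → ℕ) → Σ< k (λ j → f j + g j) ≡ Σ< k f + Σ< k g
Σ<-+ zero    f g = refl
Σ<-+ (suc k) f g = trans (cong (_+ (f k + g k)) (Σ<-+ k f g)) (shape (Σ< k f) (Σ< k g) (f k) (g k))
  where
  shape : ∀ a b c d → a + b + (c + d) ≡ a + c + (b + d)
  shape = ℕR.solve-∀

Σ<-swap : ∀ k l (f : ℕ → ℕ → ℕ) → Σ< k (λ i → Σ< l (f i)) ≡ Σ< l (λ j → Σ< k (λ i → f i j))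
Σ<-swap zero    l f = sym (Σ<-0 l)
Σ<-swap (suc k) l f = trans (cong (_+ Σ< l (f k)) (Σ<-swap k l f))
                            (sym (Σ<-+ l (λ j → Σ< k (λ i → f i j)) (f k)))

Σ<-*ˡ : ∀ k c (f : ℕ → ℕ) → Σ< k (λ j → c * f j) ≡ c * Σ< k f
Σ<-*ˡ zero    c f = sym (*-zeroʳ c)
Σ<-*ˡ (suc k) c f = trans (cong (_+ c * f k) (Σ<-*ˡ k c f)) (sym (*-distribˡ-+ c (Σ< k f) (f k)))

Σ<-product : ∀ k l (f g : ℕ → ℕ) → Σ< k (λ i → Σ< l (λ j → f i * g j)) ≡ Σ< k f * Σ< l g
Σ<-product k l f g = begin
  Σ< k (λ i → Σ< l (λ j → f i * g j)) ≡⟨ Σ<-cong k (λ i → trans (Σ<-*ˡ l (f i) g) (*-comm (f i) (Σ< l g))) ⟩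
  Σ< k (λ i → Σ< l g * f i)           ≡⟨ Σ<-*ˡ k (Σ< l g) f ⟩
  Σ< l g * Σ< k f                     ≡⟨ *-comm (Σ< l g) (Σ< k f) ⟩
  Σ< k f * Σ< l g                     ∎
  where open ≡-Reasoning

-- With `k` moved outermost, the summand separates into a factor in `n` and a factor in `m`, so each
-- sum over the box is a product of two counts.
Σ<-swap-product : ∀ C D K (a b : ℕ → ℕ → ℕ) →
  Σ< C (λ n → Σ< D (λ m → Σ< K (λ k → a k n * b k m))) ≡ Σ< K (λ k → Σ< C (a k) * Σ< D (b k))
Σ<-swap-product C D K a b = begin
  Σ< C (λ n → Σ< D (λ m → Σ< K (λ k → a k n * b k m)))
    ≡⟨ Σ<-cong C (λ n → Σ<-swap D K (λ m k → a k n * b k m)) ⟩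
  Σ< C (λ n → Σ< K (λ k → Σ< D (λ m → a k n * b k m)))
    ≡⟨ Σ<-swap C K _ ⟩
  Σ< K (λ k → Σ< C (λ n → Σ< D (λ m → a k n * b k m)))
    ≡⟨ Σ<-cong K (λ k → Σ<-product C D (a k) (b k)) ⟩
  Σ< K (λ k → Σ< C (a k) * Σ< D (b k)) ∎
  where open ≡-Reasoning

-- Multiples of `q` among consecutive integers.

[_∣_] : ℕ → ℕ → ℕ
[ q ∣ n ] with q ∣? n
... | yes _ = 1
... | no  _ = 0

-- If `suc n = suc k * q`, then `n = (q - 1) + k * q` has quotient `k`. Otherwise the remainder of
-- `n` plus one is still below `q`, and the quotient does not move.
suc-/ : ∀ q .{{_ : NonZero q}} n → suc n / q ≡ n / q + [ q ∣ suc n ]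
suc-/ q@(suc q′) n with q ∣? suc n
... | yes (divides (suc k) eq) = begin
  suc n / q                   ≡⟨ cong (_/ q) eq ⟩
  suc k * q / q               ≡⟨ m*n/n≡m (suc k) q ⟩
  suc k                       ≡⟨ +-comm 1 k ⟩
  k + 1                       ≡⟨ cong (_+ 1) n/q≡k ⟨
  n / q + 1                   ∎
  where
  open ≡-Reasoning
  n/q≡k : n / q ≡ k
  n/q≡k = begin
    n / q                  ≡⟨ cong (_/ q) (suc-injective eq) ⟩
    (q′ + k * q) / q       ≡⟨ +-distrib-/-∣ʳ q′ (n∣m*n k) ⟩
    q′ / q + k * q / q     ≡⟨ cong₂ _+_ (m<n⇒m/n≡0 (n<1+n q′)) (m*n/n≡m k q) ⟩
    k                      ∎
... | no q∤n+1 = begin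
  suc n / q                           ≡⟨ cong (_/ q) n+1≡ ⟩
  (suc (n % q) + n / q * q) / q       ≡⟨ +-distrib-/-∣ʳ (suc (n % q)) (n∣m*n (n / q)) ⟩
  suc (n % q) / q + n / q * q / q     ≡⟨ cong₂ _+_ (m<n⇒m/n≡0 r+1<q) (m*n/n≡m (n / q) q) ⟩
  n / q                               ≡⟨ +-identityʳ (n / q) ⟨
  n / q + 0                           ∎
  where
  open ≡-Reasoning
  n+1≡ : suc n ≡ suc (n % q) + n / q * q
  n+1≡ = cong suc (m≡m%n+[m/n]*n n q)
  r+1<q : suc (n % q) < q
  r+1<q = ≤∧≢⇒< (m%n<n n q) λ r+1≡q →
    q∤n+1 (divides (suc (n / q)) (trans n+1≡ (cong (_+ n / q * q) r+1≡q)))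

multiples≤C : ∀ q .{{_ : NonZero q}} C → Σ< C (λ n → [ q ∣ suc n ]) ≡ C / q
multiples≤C q zero    = sym (0/n≡0 q)
multiples≤C q (suc C) = trans (cong (_+ [ q ∣ suc C ]) (multiples≤C q C)) (sym (suc-/ q C))

-- Telescoping of `suc-/` downwards from `A`. The quotient of `A ∸ C` stands on the left to avoid
-- truncated subtraction.
multiples-below : ∀ q .{{_ : NonZero q}} A C → C ≤ A →
                  (A ∸ C) / q + Σ< C (λ n → [ q ∣ A ∸ n ]) ≡ A / q
multiples-below q A zero    _   = +-identityʳ (A / q)
multiples-below q A (suc C) C<A = begin
  (A ∸ suc C) / q + (S + [ q ∣ A ∸ C ])  ≡⟨ shape ((A ∸ suc C) / q) S [ q ∣ A ∸ C ] ⟩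
  (A ∸ suc C) / q + [ q ∣ A ∸ C ] + S    ≡⟨ cong (λ z → (A ∸ suc C) / q + [ q ∣ z ] + S) A∸C ⟩
  (A ∸ suc C) / q + [ q ∣ suc (A ∸ suc C) ] + S ≡⟨ cong (_+ S) (suc-/ q (A ∸ suc C)) ⟨
  suc (A ∸ suc C) / q + S                ≡⟨ cong (λ z → z / q + S) A∸C ⟨
  (A ∸ C) / q + S                        ≡⟨ multiples-below q A C (<⇒≤ C<A) ⟩
  A / q                                  ∎
  where
  open ≡-Reasoning
  S = Σ< C (λ n → [ q ∣ A ∸ n ])
  A∸C : A ∸ C ≡ suc (A ∸ suc C)
  A∸C = +-∸-assoc 1 C<A
  shape : ∀ a b c → a + (b + c) ≡ a + c + b
  shape = ℕR.solve-∀

/-superadditive : ∀ q .{{_ : NonZero q}} m n → m / q + n / q ≤ (m + n) / q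
/-superadditive q m n = begin
  m / q + n / q             ≡⟨ m*n/n≡m (m / q + n / q) q ⟨
  (m / q + n / q) * q / q   ≤⟨ /-monoˡ-≤ q (begin
    (m / q + n / q) * q       ≡⟨ *-distribʳ-+ q (m / q) (n / q) ⟩
    m / q * q + n / q * q     ≤⟨ +-mono-≤ (m/n*n≤m m q) (m/n*n≤m n q) ⟩
    m + n                     ∎) ⟩
  (m + n) / q               ∎
  where open ≤-Reasoning

-- After adding `(A ∸ C) / q`, the right side telescopes to `A / q`, and the inequality becomes
-- superadditivity of the floor.
multiples-minimal : ∀ q .{{_ : NonZero q}} A C → C ≤ A →
                    Σ< C (λ n → [ q ∣ suc n ]) ≤ Σ< C (λ n → [ q ∣ A ∸ n ])
multiples-minimal q A C C≤A = +-cancelˡ-≤ ((A ∸ C) / q) _ _ (begin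
  (A ∸ C) / q + Σ< C (λ n → [ q ∣ suc n ]) ≡⟨ cong (λ z → (A ∸ C) / q + z) (multiples≤C q C) ⟩
  (A ∸ C) / q + C / q                      ≤⟨ /-superadditive q (A ∸ C) C ⟩
  (A ∸ C + C) / q                          ≡⟨ cong (_/ q) (m∸n+n≡m C≤A) ⟩
  A / q                                    ≡⟨ multiples-below q A C C≤A ⟨
  (A ∸ C) / q + Σ< C (λ n → [ q ∣ A ∸ n ]) ∎)
  where open ≤-Reasoning

-- The valuation of `x + iy`, cut off at `K`.

-- For x + iy ≠ 0, p inert in ℤ[i] and K large this is the p-adic valuation
-- min(v(x), v(y)) of x + iy; it is finite for x + iy = 0 only because of the cut-off K.
val : (p K x y : ℕ) → ℕ
val p K x y = Σ< K λ k → [ p ^ suc k ∣ x ] * [ p ^ suc k ∣ y ]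

val-minimal : ∀ p .{{_ : NonZero p}} K A B C D → C ≤ A → D ≤ B →
  Σ< C (λ n → Σ< D (λ m → val p K (suc n) (suc m))) ≤ Σ< C (λ n → Σ< D (λ m → val p K (A ∸ n) (B ∸ m)))
val-minimal p K A B C D C≤A D≤B = begin
  Σ< C (λ n → Σ< D (λ m → val p K (suc n) (suc m)))
    ≡⟨ Σ<-swap-product C D K (λ k n → [ p ^ suc k ∣ suc n ]) (λ k m → [ p ^ suc k ∣ suc m ]) ⟩
  Σ< K (λ k → Σ< C (λ n → [ p ^ suc k ∣ suc n ]) * Σ< D (λ m → [ p ^ suc k ∣ suc m ]))
    ≤⟨ Σ<-mono K (λ k → *-mono-≤ (multiples-minimal (p ^ suc k) {{m^n≢0 p (suc k)}} A C C≤A)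
                                 (multiples-minimal (p ^ suc k) {{m^n≢0 p (suc k)}} B D D≤B)) ⟩
  Σ< K (λ k → Σ< C (λ n → [ p ^ suc k ∣ A ∸ n ]) * Σ< D (λ m → [ p ^ suc k ∣ B ∸ m ]))
    ≡⟨ Σ<-swap-product C D K (λ k n → [ p ^ suc k ∣ A ∸ n ]) (λ k m → [ p ^ suc k ∣ B ∸ m ]) ⟨
  Σ< C (λ n → Σ< D (λ m → val p K (A ∸ n) (B ∸ m))) ∎
  where open ≤-Reasoning

^-∣-^ : ∀ p {m n} → m ≤ n → p ^ m ∣ p ^ n
^-∣-^ p {m} {n} m≤n = divides (p ^ (n ∸ m))
  (trans (cong (p ^_) (sym (m∸n+n≡m m≤n))) (^-distribˡ-+-* p (n ∸ m) m))

[]-yes : ∀ {q x} → q ∣ x → [ q ∣ x ] ≡ 1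
[]-yes {q} {x} h with q ∣? x
... | yes _ = refl
... | no ¬h = ⊥-elim (¬h h)

[]-no : ∀ {q x y} → ¬ (q ∣ x × q ∣ y) → [ q ∣ x ] * [ q ∣ y ] ≡ 0
[]-no {q} {x} {y} h with q ∣? x | q ∣? y
... | yes a | yes b = ⊥-elim (h (a , b))
... | yes a | no  _ = refl
... | no  _ | _ = refl

-- Divisibility by a power of `p` passes to smaller powers, so the summands of `val` are a run of
-- ones followed by zeros, and `val` is the length of the run. Either the run fills all `K` places,
-- or it has stopped and every later summand vanishes.
val-saturated⊎exact : ∀ p K x y →
  (val p K x y ≡ K × p ^ K ∣ x × p ^ K ∣ y) ⊎
  (val p K x y < K × (p ^ val p K x y ∣ x × p ^ val p K x y ∣ y) ×
   ¬ (p ^ suc (val p K x y) ∣ x × p ^ suc (val p K x y) ∣ y))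
val-saturated⊎exact p zero x y = inj₁ (refl , 1∣ x , 1∣ y)
val-saturated⊎exact p (suc K) x y with val-saturated⊎exact p K x y
... | inj₂ (lt , d , nd)
      rewrite []-no {p ^ suc K} {x} {y} (λ (a , b) → nd (∣-trans (^-∣-^ p (s≤s (<⇒≤ lt))) a ,
                                                         ∣-trans (^-∣-^ p (s≤s (<⇒≤ lt))) b))
            | +-identityʳ (val p K x y) = inj₂ (m<n⇒m<1+n lt , d , nd)
... | inj₁ (eq , d) with (p ^ suc K ∣? x) ×-dec (p ^ suc K ∣? y)
...   | yes (a , b) rewrite []-yes a | []-yes b | eq = inj₁ (+-comm K 1 , a , b)
...   | no nd rewrite []-no {p ^ suc K} {x} {y} nd | eq | +-identityʳ K = inj₂ (n<1+n K , d , nd)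

^val∣ : ∀ p K x y → p ^ val p K x y ∣ x × p ^ val p K x y ∣ y
^val∣ p K x y with val-saturated⊎exact p K x y
... | inj₁ (eq , d) rewrite eq = d
... | inj₂ (_ , d , _) = d

-- A nonzero `x` below `p ^ K` is not divisible by `p ^ K`, which excludes the saturated case.
^suc-val∤ : ∀ p K x .{{_ : NonZero x}} y → x < p ^ K →
            ¬ (p ^ suc (val p K x y) ∣ x × p ^ suc (val p K x y) ∣ y)
^suc-val∤ p K x y x<p^K with val-saturated⊎exact p K x y
... | inj₁ (_ , p^K∣x , _) = ⊥-elim (>⇒∤ x<p^K p^K∣x)
... | inj₂ (_ , _ , nd) = nd

n<m^n : ∀ m → 1 < m → ∀ n → n < m ^ n
n<m^n m 1<m zero    = z<s
n<m^n m 1<m (suc n) = ≤-<-trans (n<m^n m 1<m n) (^-monoʳ-< m 1<m (n<1+n n))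

-- Gaussian integers inside ℚ(i).

ℕ→ℚ : ℕ → ℚ
ℕ→ℚ n = ℤ→ℚ (+ n)

ℕ→ℚ-* : ∀ m n → ℕ→ℚ (m * n) ≡ ℕ→ℚ m ℚ.* ℕ→ℚ n
ℕ→ℚ-* m n = trans (cong ℤ→ℚ (ℤP.pos-* m n)) (ℤ→ℚ-* (+ m) (+ n))

ℤ→ℚ-+ : ∀ m n → ℤ→ℚ (m ℤ.+ n) ≡ ℤ→ℚ m ℚ.+ ℤ→ℚ n
ℤ→ℚ-+ m n = begin
  s                       ≡⟨ solve 2 (λ s n → s := s :- n :+ n) refl s (ℤ→ℚ n) ⟩
  s ℚ.- ℤ→ℚ n ℚ.+ ℤ→ℚ n   ≡⟨ cong (ℚ._+ ℤ→ℚ n) (ℤ→ℚ-- (m ℤ.+ n) n) ⟨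
  ℤ→ℚ (m ℤ.+ n ℤ.- n) ℚ.+ ℤ→ℚ n ≡⟨ cong (λ z → ℤ→ℚ z ℚ.+ ℤ→ℚ n) m+n-n ⟩
  ℤ→ℚ m ℚ.+ ℤ→ℚ n         ∎
  where
  open ≡-Reasoning
  open +-*-Solver
  s = ℤ→ℚ (m ℤ.+ n)
  m+n-n : m ℤ.+ n ℤ.- n ≡ m
  m+n-n = trans (ℤP.+-assoc m n (ℤ.- n)) (trans (cong (λ z → m ℤ.+ z) (ℤP.+-inverseʳ n)) (ℤP.+-identityʳ m))

ℕ→ℚ-∸ : ∀ {m n} → n ≤ m → ℕ→ℚ m ℚ.- ℕ→ℚ n ≡ ℕ→ℚ (m ∸ n)
ℕ→ℚ-∸ {m} {n} n≤m = trans (sym (ℤ→ℚ-- (+ m) (+ n)))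
  (cong ℤ→ℚ (trans (ℤP.m-n≡m⊖n m n) (ℤP.⊖-≥ n≤m)))

infixr 8 _·_
_·_ : ℚ → ℚ[i] → ℚ[i]
r · (a +i b) = r ℚ.* a +i r ℚ.* b

·-⊗ : ∀ r s z w → (r · z) ⊗ (s · w) ≡ (r ℚ.* s) · (z ⊗ w)
·-⊗ r s (a +i b) (c +i d) = cong₂ _+i_
  (solve 6 (λ r s a b c d → (r :* a) :* (s :* c) :- (r :* b) :* (s :* d) := (r :* s) :* (a :* c :- b :* d)) refl r s a b c d)
  (solve 6 (λ r s a b c d → (r :* a) :* (s :* d) :+ (r :* b) :* (s :* c) := (r :* s) :* (a :* d :+ b :* c)) refl r s a b c d)
  where open +-*-Solver

data ℤ[i] : ℚ[i] → Set where
  _+i_ : ∀ a b → ℤ[i] (ℤ→ℚ a +i ℤ→ℚ b)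

ℤ[i]-⊗ : ∀ {z w} → ℤ[i] z → ℤ[i] w → ℤ[i] (z ⊗ w)
ℤ[i]-⊗ (a +i b) (c +i d) = subst ℤ[i]
  (cong₂ _+i_ (trans (ℤ→ℚ-- (a ℤ.* c) (b ℤ.* d)) (cong₂ ℚ._-_ (ℤ→ℚ-* a c) (ℤ→ℚ-* b d)))
              (trans (ℤ→ℚ-+ (a ℤ.* d) (b ℤ.* c)) (cong₂ ℚ._+_ (ℤ→ℚ-* a d) (ℤ→ℚ-* b c))))
  ((a ℤ.* c ℤ.- b ℤ.* d) +i (a ℤ.* d ℤ.+ b ℤ.* c))

conj : ℚ[i] → ℚ[i]
conj (a +i b) = a +i ℚ.- b

ℤ[i]-conj : ∀ {z} → ℤ[i] z → ℤ[i] (conj z)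
ℤ[i]-conj (a +i b) = subst (λ y → ℤ[i] (ℤ→ℚ a +i y))
  (trans (cong ℤ→ℚ (sym (ℤP.+-identityˡ (ℤ.- b)))) (trans (ℤ→ℚ-- (+ 0) b) (ℚP.+-identityˡ (ℚ.- ℤ→ℚ b))))
  (a +i ℤ.- b)

-- Divisibility by powers of `p` and exact valuations.

record Multiple (p e : ℕ) (z : ℚ[i]) : Set where
  constructor multiple
  field
    {cofactor} : ℚ[i]
    integral   : ℤ[i] cofactor
    factors    : z ≡ ℕ→ℚ (p ^ e) · cofactor

-- The condition on the norm makes z / pᵉ a unit of ℤₚ[i].
record Exact (p e : ℕ) (z : ℚ[i]) : Set where
  constructor exact
  field
    z∈pᵉ : Multiple p e z
    {n} : ℕ
    p∤n : p ∤ n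
    norm≡n : norm (Multiple.cofactor z∈pᵉ) ≡ ℕ→ℚ n

∤1 : ∀ {p} → Prime p → p ∤ 1
∤1 pp p∣1 = nonTrivial⇒≢1 {{prime⇒nonTrivial pp}} (∣1⇒≡1 p∣1)

Multiple-1 : ∀ p → Multiple p 0 1[i]
Multiple-1 p = multiple ((+ 1) +i (+ 0)) refl

Multiple-⊗ : ∀ {p e f z w} → Multiple p e z → Multiple p f w → Multiple p (e + f) (z ⊗ w)
Multiple-⊗ {p} {e} {f} (multiple {u} u∈ z≡) (multiple {v} v∈ w≡) = multiple (ℤ[i]-⊗ u∈ v∈)
  (trans (cong₂ _⊗_ z≡ w≡) (trans (·-⊗ (ℕ→ℚ (p ^ e)) (ℕ→ℚ (p ^ f)) u v)
    (cong (_· (u ⊗ v)) (trans (sym (ℕ→ℚ-* (p ^ e) (p ^ f))) (cong ℕ→ℚ (sym (^-distribˡ-+-* p e f)))))))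

Exact-1 : ∀ {p} → Prime p → Exact p 0 1[i]
Exact-1 {p} pp = exact (Multiple-1 p) {1} (∤1 pp) refl

-- The norms of the cofactors multiply, so Euclid's lemma in ℕ keeps the new norm prime to `p`.
Exact-⊗ : ∀ {p e f z w} → Prime p → Exact p e z → Exact p f w → Exact p (e + f) (z ⊗ w)
Exact-⊗ pp (exact z∈@(multiple {u} _ _) {m} p∤m Nu) (exact w∈@(multiple {v} _ _) {n} p∤n Nv) =
  exact (Multiple-⊗ z∈ w∈) {m * n}
    (λ h → [ p∤m , p∤n ]′ (euclidsLemma m n pp h))
    (trans (norm-⊗ u v) (trans (cong₂ ℚ._*_ Nu Nv) (sym (ℕ→ℚ-* m n))))

-- Serves both `Multiple p` and `Exact p`; nesting it handles the double products. The bound `j < k`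
-- carries the index range to the factors.
∏-graded : (Q : ℕ → ℚ[i] → Set) → Q 0 1[i] → (∀ {e f z w} → Q e z → Q f w → Q (e + f) (z ⊗ w)) →
           ∀ k {e f} → (∀ j → j < k → Q (e j) (f j)) → Q (Σ< k e) (∏ k f)
∏-graded Q Q1 Q⊗ zero    h = Q1
∏-graded Q Q1 Q⊗ (suc k) {e} {f} h =
  Q⊗ (∏-graded Q Q1 Q⊗ k {e} {f} (λ j j<k → h j (m<n⇒m<1+n j<k))) (h k (n<1+n k))

Multiple-weaken : ∀ {p e f z} → e ≤ f → Multiple p f z → Multiple p e z
Multiple-weaken {p} {e} {f} e≤f (multiple {_} (a +i b) refl) = multiple ((d ℤ.* a) +i (d ℤ.* b))
  (cong₂ _+i_ (split a) (split b))
  where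
  d = + (p ^ (f ∸ e))
  split : ∀ c → ℕ→ℚ (p ^ f) ℚ.* ℤ→ℚ c ≡ ℕ→ℚ (p ^ e) ℚ.* ℤ→ℚ (d ℤ.* c)
  split c = begin
    ℕ→ℚ (p ^ f) ℚ.* ℤ→ℚ c ≡⟨ cong (λ k → ℕ→ℚ (p ^ k) ℚ.* ℤ→ℚ c) (m+[n∸m]≡n e≤f) ⟨
    ℕ→ℚ (p ^ (e + (f ∸ e))) ℚ.* ℤ→ℚ c ≡⟨ cong (λ q → ℕ→ℚ q ℚ.* ℤ→ℚ c) (^-distribˡ-+-* p e (f ∸ e)) ⟩
    ℕ→ℚ (p ^ e * p ^ (f ∸ e)) ℚ.* ℤ→ℚ c ≡⟨ cong (ℚ._* ℤ→ℚ c) (ℕ→ℚ-* (p ^ e) (p ^ (f ∸ e))) ⟩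
    ℕ→ℚ (p ^ e) ℚ.* ℤ→ℚ d ℚ.* ℤ→ℚ c ≡⟨ ℚP.*-assoc (ℕ→ℚ (p ^ e)) (ℤ→ℚ d) (ℤ→ℚ c) ⟩
    ℕ→ℚ (p ^ e) ℚ.* (ℤ→ℚ d ℚ.* ℤ→ℚ c) ≡⟨ cong (ℕ→ℚ (p ^ e) ℚ.*_) (ℤ→ℚ-* d c) ⟨
    ℕ→ℚ (p ^ e) ℚ.* ℤ→ℚ (d ℤ.* c) ∎
    where open ≡-Reasoning

Multiple-+i : ∀ {p e x y} → p ^ e ∣ x → p ^ e ∣ y → Multiple p e (x + y i)
Multiple-+i {p} {e} (divides x′ refl) (divides y′ refl) = multiple ((+ x′) +i (+ y′))
  (cong₂ _+i_ (pull x′) (pull y′))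
  where
  pull : ∀ z → ℕ→ℚ (z * p ^ e) ≡ ℕ→ℚ (p ^ e) ℚ.* ℕ→ℚ z
  pull z = trans (ℕ→ℚ-* z (p ^ e)) (ℚP.*-comm (ℕ→ℚ z) (ℕ→ℚ (p ^ e)))

-- If `p` divided the cofactor's norm `x′² + y′²`, it would divide both `x′` and `y′`, and then
-- `p ^ suc e` would divide both coordinates.
Exact-+i : ∀ {p e x y} → Prime p → p % 4 ≡ 3 → p ^ e ∣ x → p ^ e ∣ y →
           ¬ (p ^ suc e ∣ x × p ^ suc e ∣ y) → Exact p e (x + y i)
Exact-+i {p} {e} pp p≡3 (divides x′ refl) (divides y′ refl) nd =
  exact (Multiple-+i (divides x′ refl) (divides y′ refl)) {x′ * x′ + y′ * y′}
    (λ h → nd ( *-monoˡ-∣ (p ^ e) (∣x²+y²⇒∣y pp p≡3 y′ x′ (subst (p ∣_) (+-comm (x′ * x′) (y′ * y′)) h))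
              , *-monoˡ-∣ (p ^ e) (∣x²+y²⇒∣y pp p≡3 x′ y′ h)))
    (sym (trans (ℤ→ℚ-+ (+ (x′ * x′)) (+ (y′ * y′))) (cong₂ ℚ._+_ (ℕ→ℚ-* x′ x′) (ℕ→ℚ-* y′ y′))))

numerator-Multiple : ∀ {p} K A B C D → C ≤ A → D ≤ B →
  Multiple p (Σ< C λ n → Σ< D λ m → val p K (A ∸ n) (B ∸ m)) (numerator A B C D)
numerator-Multiple {p} K A B C D C≤A D≤B =
  ∏-graded (Multiple p) (Multiple-1 p) Multiple-⊗ C λ n n<C →
  ∏-graded (Multiple p) (Multiple-1 p) Multiple-⊗ D λ m m<D →
    subst (Multiple p _)
      -- The index bounds give `n ≤ A` and `m ≤ B`, so truncated subtraction agrees with subtraction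
      -- in ℚ.
      (cong₂ _+i_ (sym (ℕ→ℚ-∸ (<⇒≤ (<-≤-trans n<C C≤A)))) (sym (ℕ→ℚ-∸ (<⇒≤ (<-≤-trans m<D D≤B)))))
      (let (a , b) = ^val∣ p K (A ∸ n) (B ∸ m) in Multiple-+i a b)

denominator-Exact : ∀ {p} → Prime p → p % 4 ≡ 3 → ∀ C D →
  Exact p (Σ< C λ n → Σ< D λ m → val p C (suc n) (suc m)) (denominator C D)
denominator-Exact {p} pp p≡3 C D =
  ∏-graded (Exact p) (Exact-1 pp) (Exact-⊗ pp) C λ n n<C →
  ∏-graded (Exact p) (Exact-1 pp) (Exact-⊗ pp) D λ m m<D →
    let (a , b) = ^val∣ p C (suc n) (suc m) in
    -- The cut-off `C` is large enough, since `suc n ≤ C < p ^ C`.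
    Exact-+i pp p≡3 a b (^suc-val∤ p C (suc n) (suc m) (≤-<-trans n<C (n<m^n p 1<p C)))
  where
  1<p : 1 < p
  1<p = nonTrivial⇒n>1 p {{prime⇒nonTrivial pp}}

-- Integrality of the quotient.

-- t is 1 / norm (r · u), so that the right factor is inv (r · u).
conj-quotient : ∀ r w u t → norm (r · u) ℚ.* t ≡ 1ℚ →
  norm u · ((r · w) ⊗ ((r ℚ.* re u ℚ.* t) +i (ℚ.- (r ℚ.* im u) ℚ.* t))) ≡ w ⊗ conj u
conj-quotient r (c +i d) (a +i b) t Nt≡1 = cong₂ _+i_
  (trans (solve 6 (λ r a b c d t →
      (a :* a :+ b :* b) :* ((r :* c) :* ((r :* a) :* t) :- (r :* d) :* ((:- (r :* b)) :* t))
      := (((r :* a) :* (r :* a) :+ (r :* b) :* (r :* b)) :* t) :* (c :* a :- d :* (:- b))) refl r a b c d t)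
    (unit (c ℚ.* a ℚ.- d ℚ.* (ℚ.- b))))
  (trans (solve 6 (λ r a b c d t →
      (a :* a :+ b :* b) :* ((r :* c) :* ((:- (r :* b)) :* t) :+ (r :* d) :* ((r :* a) :* t))
      := (((r :* a) :* (r :* a) :+ (r :* b) :* (r :* b)) :* t) :* (c :* (:- b) :+ d :* a)) refl r a b c d t)
    (unit (c ℚ.* (ℚ.- b) ℚ.+ d ℚ.* a)))
  where
  open +-*-Solver
  unit : ∀ q → (norm (r · (a +i b)) ℚ.* t) ℚ.* q ≡ q
  unit q = trans (cong (ℚ._* q) Nt≡1) (ℚP.*-identityˡ q)

-- The scalar `r` cancels and `1/u` is `conj u / norm u`. Clearing that norm leaves a product that
-- is a Gaussian integer whenever `w` and `u` are.
⊘-cancel : ∀ r w u .{{_ : ℚ.NonZero (norm (r · u))}} →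
           norm u · ((r · w) ⊘ (r · u)) ≡ w ⊗ conj u
⊘-cancel r w u = conj-quotient r w u (ℚ.1/ norm (r · u)) (ℚP.*-inverseʳ (norm (r · u)))

ℤ[i]-parts : ∀ {z} → ℤ[i] z → (∃ λ a → re z ≡ ℤ→ℚ a) × (∃ λ b → im z ≡ ℤ→ℚ b)
ℤ[i]-parts (a +i b) = (a , refl) , (b , refl)

-- `n` is a common denominator, prime to `p`, of both coordinates; the embedded sequences are
-- constant, so the threshold is 0.
unit-multiple-∈ℤₚ[i] : ∀ {p n} (pp : Prime p) → p ∤ n → ∀ z → ℤ[i] (ℕ→ℚ n · z) → embed pp z ∈ℤₚ[i]
unit-multiple-∈ℤₚ[i] {p} {n} pp p∤n (x +i y) nz∈ =
  (0 , λ _ _ → part x (proj₁ (ℤ[i]-parts nz∈))) , (0 , λ _ _ → part y (proj₂ (ℤ[i]-parts nz∈)))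
  where
  part : ∀ q → (∃ λ a → ℕ→ℚ n ℚ.* q ≡ ℤ→ℚ a) → ∣ q ∣[ p ]≤^- 0
  part q (a , eq) = a , n , p∤n ,
    trans (ℚP.*-comm q (ℕ→ℚ n)) (trans eq (cong ℤ→ℚ (sym (ℤP.*-identityˡ a))))

-- The equal powers of `p` cancel, and what remains has the norm of the denominator's cofactor as
-- denominator, which is prime to `p`.
Multiple⊘Exact : ∀ {p e z w} → (pp : Prime p) → Multiple p e z → Exact p e w →
  .{{_ : ℚ.NonZero (norm w)}} → embed pp (z ⊘ w) ∈ℤₚ[i]
Multiple⊘Exact {p} {e} pp (multiple {v} v∈ refl) (exact (multiple {u} u∈ refl) {n} p∤n Nu) =
  unit-multiple-∈ℤₚ[i] pp p∤n ((r · v) ⊘ (r · u))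
    (subst (λ s → ℤ[i] (s · ((r · v) ⊘ (r · u)))) Nu
      (subst ℤ[i] (sym (⊘-cancel r v u)) (ℤ[i]-⊗ v∈ (ℤ[i]-conj u∈))))
  where r = ℕ→ℚ (p ^ e)

lemma2p1 : (p : ℕ) (p-prime : Prime p) → 2 ∤ p → p % 4 ≡ 3 →
    (A B C D : ℕ) → 1 ≤ C → C ≤ A → 1 ≤ D → D ≤ B →
    embed p-prime (ℛ A B C D) ∈ℤₚ[i]
lemma2p1 p pp _ p≡3 A B C D _ C≤A _ D≤B =
  Multiple⊘Exact pp
    -- The cut-off is `C` on both sides: the denominator's valuation is exact there, and for the
    -- numerator a truncated valuation is still a lower bound.
    (Multiple-weaken (val-minimal p {{prime⇒nonZero pp}} C A B C D C≤A D≤B) (numerator-Multiple C A B C D C≤A D≤B))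
    (denominator-Exact pp p≡3 C D) {{denominator≢0 C D}}
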